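{- Let $H$ be a graph. The following are equivalent: (i) for every $H$-free graph $G$ and every integer $\ell \ge \chi(G)+1$, the graph $G$ is $\ell$-mixing; (ii) $H$ is an induced subgraph of $P_4$ or an induced subgraph of $P_3+P_1$.
   Context: All graphs are finite and simple. A $k$-colouring of $G$ is a map $\alpha: V(G)\to\{1,\dots,k\}$ with $\alpha(u)\neq\alpha(v)$ for every edge $uv$; $\chi(G)$ is the least $k$ for which a $k$-colouring exists. The reconfiguration graph $\mathcal{R}_k(G)$ has the $k$-colourings of $G$ as vertices, two colourings being adjacent if they differ on exactly one vertex. $G$ is $k$-mixing if $\mathcal{R}_k(G)$ is connected. A graph is $H$-free if it has no induced subgraph isomorphic to $H$. $P_n$ is the path on $n$ vertices, and $G_1+G_2$ denotes the disjoint union of $G_1$ and $G_2$. -}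

module Defs where

open import Data.Fin using (Fin; toℕ; splitAt; finToFun; funToFin)
open import Data.Fin.Properties using (any?; all?; finToFun-funToFin)
import Data.Fin.Properties as Fin
open import Data.Nat using (ℕ; zero; suc; _+_; _^_; _≤_; z≤n; s≤s)
import Data.Nat.Properties as ℕ
open import Data.Product using (∃; ∃-syntax; _×_; _,_; proj₁; proj₂)
open import Data.Sum using (_⊎_; inj₁; inj₂; swap)
open import Data.Sum.Relation.Binary.Pointwise
  using (Pointwise; ⊎-symmetric; ⊎-irreflexive; ⊎-decidable; ≡⇒Pointwise-≡)
open import Function using (_∘_; _⇔_; Injective)
open import Level using (0ℓ)
open import Relation.Binary using (Rel; Decidable; Symmetric; Irreflexive)
open import Relation.Binary.Construct.Closure.ReflexiveTransitive using (Star)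
open import Relation.Binary.PropositionalEquality
  using (_≡_; _≢_; _≗_; refl; sym; trans; cong)
open import Relation.Nullary using (Dec; yes; no; ¬_; ¬?; contradiction)
open import Relation.Nullary.Decidable using (_⊎-dec_; _→-dec_; map′)
import Relation.Unary as Unary

record Graph : Set₁ where
  infix 4 _~_ _~?_
  field
    order    : ℕ
    _~_      : Rel (Fin order) 0ℓ
    _~?_     : Decidable _~_
    ~-sym    : Symmetric _~_
    ~-irrefl : Irreflexive _≡_ _~_

  Vertex : Set
  Vertex = Fin order

-- An injection preserving and reflecting adjacency is an isomorphism of H onto
-- the subgraph of G induced by its image.
record InducedSubgraph (H G : Graph) : Set where
  private
    module H = Graph H
    module G = Graph G
  field
    embed     : H.Vertex → G.Vertex
    injective : Injective _≡_ _≡_ embed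
    adjacency : ∀ u v → (u H.~ v) ⇔ (embed u G.~ embed v)

infix 4 _-free_
_-free_ : Graph → Graph → Set
H -free G = ¬ InducedSubgraph H G

path : ℕ → Graph
path n = record
  { order    = n
  ; _~_      = λ i j → suc (toℕ i) ≡ toℕ j ⊎ suc (toℕ j) ≡ toℕ i
  ; _~?_     = λ i j → (suc (toℕ i) ℕ.≟ toℕ j) ⊎-dec (suc (toℕ j) ℕ.≟ toℕ i)
  ; ~-sym    = swap
  ; ~-irrefl = λ { refl (inj₁ e) → ℕ.1+n≢n e ; refl (inj₂ e) → ℕ.1+n≢n e }
  }

infixl 6 _⊕_
_⊕_ : Graph → Graph → Graph
G ⊕ H = record
  { order    = G.order + H.order
  ; _~_      = λ u v → Pointwise G._~_ H._~_ (splitAt G.order u) (splitAt G.order v)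
  ; _~?_     = λ u v → ⊎-decidable G._~?_ H._~?_ (splitAt G.order u) (splitAt G.order v)
  ; ~-sym    = ⊎-symmetric G.~-sym H.~-sym
  ; ~-irrefl = λ u≡v → ⊎-irreflexive G.~-irrefl H.~-irrefl
                         (≡⇒Pointwise-≡ (cong (splitAt G.order) u≡v))
  }
  where
  module G = Graph G
  module H = Graph H

module _ (G : Graph) where
  open Graph G

  record Colouring (k : ℕ) : Set where
    field
      colour : Vertex → Fin k
      proper : ∀ u v → u ~ v → colour u ≢ colour v

  open Colouring

  IsChromaticNumber : ℕ → Set
  IsChromaticNumber k = Colouring k × (∀ j → Colouring j → k ≤ j)

  -- Adjacency in the reconfiguration graph: exactly one vertex changes colour.
  Recolour : ∀ {k} → Rel (Colouring k) 0ℓ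
  Recolour α β =
    ∃[ v ] (colour α v ≢ colour β v × (∀ w → w ≢ v → colour α w ≡ colour β w))

  -- Colourings are identified when they agree as maps (_≡_ on the records is
  -- finer in the absence of function extensionality), hence the final _≗_.
  Mixing : ℕ → Set
  Mixing k = (α β : Colouring k) →
    ∃[ γ ] (Star Recolour α γ × colour γ ≗ colour β)

  colouring? : ∀ k → Dec (Colouring k)
  colouring? k = map′ to from (any? {n = k ^ order} λ i →
    all? λ u → all? λ v → (u ~? v) →-dec ¬? (finToFun i u Fin.≟ finToFun i v))
    where
    Code : Fin (k ^ order) → Set
    Code i = ∀ u v → u ~ v → finToFun i u ≢ finToFun i v

    to : ∃ Code → Colouring k
    to (i , p) = record { colour = finToFun i ; proper = p }

    from : Colouring k → ∃ Code
    from α = funToFin (colour α) , λ u v u~v e → proper α u v u~v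
      (trans (sym (finToFun-funToFin (colour α) u))
        (trans e (finToFun-funToFin (colour α) v)))

  distinctColours : Colouring order
  distinctColours = record { colour = λ v → v ; proper = λ u v u~v u≡v → ~-irrefl u≡v u~v }

least : {P : ℕ → Set} → Unary.Decidable P → ∀ n → P n →
        ∃[ m ] (P m × (∀ j → P j → m ≤ j))
least P? n p with P? zero
least P? n       p | yes p₀ = zero , p₀ , λ _ _ → z≤n
least P? zero    p | no ¬p₀ = contradiction p ¬p₀
least {P} P? (suc n) p | no ¬p₀ with least (P? ∘ suc) n p
... | m , pm , min = suc m , pm , min′
  where
  min′ : ∀ j → P j → suc m ≤ j
  min′ zero    q = contradiction q ¬p₀
  min′ (suc j) q = s≤s (min j q)

-- Opaque, so that χ of a concrete graph is never evaluated by exhaustive search;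
-- χ-isChromaticNumber characterises it.
opaque
  chromatic : (G : Graph) → ∃ (IsChromaticNumber G)
  chromatic G = least (colouring? G) (Graph.order G) (distinctColours G)

χ : Graph → ℕ
χ G = proj₁ (chromatic G)

χ-isChromaticNumber : (G : Graph) → IsChromaticNumber G (χ G)
χ-isChromaticNumber G = proj₂ (chromatic G)

{-# OPTIONS --safe #-}
module Submission where

-- (i) ⇒ (ii).  A frozen colouring, in which every vertex sees all the colours but
-- its own, is isolated in the reconfiguration graph.  C₆ has a frozen 3-colouring
-- and a 2-colouring, so H embeds in C₆; a (P₂+P₂)-free graph G₁₀ has a frozen
-- 5-colouring and a 4-colouring, so H is (P₂+P₂)-free.  Hence H misses two vertices
-- of C₆ that are not antipodal, which leaves P₄ or P₃+P₁.
--
-- (ii) ⇒ (i).  The vertices of G split into a P₄-free part T and a part without an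
-- independent triple, completely joined to each other: if G is P₄-free, T is
-- everything, and if G is (P₃+P₁)-free, T consists of the vertices lying in some
-- independent triple.  Fix a colouring β with m colours and let α have m + 1.  While
-- α uses all its colours, lower the colour of a vertex of T, or give a vertex y
-- outside T the colour of a vertex x that has its α-colour to itself and whose
-- β-class is {x, y}.  When neither move is possible, P₄-freeness yields a clique in T
-- meeting every colour of T, and counting two tokens per colour of α against β
-- contradicts that β has fewer colours.  So some colour f becomes free; recolour a
-- class of β to f, and remove it together with f, to induct on the number of colours.

open import Defs
open import Data.Bool using (Bool; true; false; if_then_else_)
import Data.Bool as Bool
open import Data.Empty using (⊥; ⊥-elim)
open import Data.Fin
  using ( Fin; zero; suc; toℕ; fromℕ; fromℕ<; inject₁; finToFun; funToFin; punchIn; punchOut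
        ; combine; remQuot)
open import Data.Fin.Patterns using (0F; 1F; 2F; 3F; 4F)
open import Data.Fin.Properties
  using ( _≟_; any?; all?; toℕ<n; toℕ-fromℕ; toℕ-fromℕ<; toℕ-injective; fromℕ<-injective
        ; fromℕ≢inject₁; inject₁-injective; finToFun-funToFin; punchInᵢ≢i; punchIn-injective
        ; punchIn-punchOut; combine-injective; combine-remQuot; <⇒notInjective)
open import Data.Nat using (ℕ; zero; suc; _+_; _∸_; _*_; _^_; _≤_; _<_; _≥_; _⊓_; z≤n; s≤s; s≤s⁻¹)
import Data.Nat as ℕ
open import Data.Nat.DivMod using (_mod_)
open import Data.Nat.Induction using (<-wellFounded; Acc; acc)
import Data.Nat.Properties as ℕ
open import Algebra.Properties.Monoid.Sum ℕ.+-0-monoid using (sum)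
open import Data.Product using (∃; ∃-syntax; ∃₂; _×_; _,_; proj₁; proj₂; uncurry)
open import Data.Sum using (_⊎_; inj₁; inj₂)
open import Data.Unit using (⊤; tt)
open import Data.Vec using (Vec; []; _∷_; lookup)
open import Data.Vec.Functional using (updateAt)
open import Data.Vec.Functional.Properties using (updateAt-updates; updateAt-minimal)
open import Function using (_⇔_; mk⇔; Equivalence; _∘_; const; id)
open import Level using (0ℓ)
open import Relation.Binary using (Rel; Reflexive; Symmetric; tri<; tri≈; tri>)
open import Relation.Binary.Construct.Closure.ReflexiveTransitive
  using (Star; ε; _◅_; _◅◅_; gmap; reverse)
open import Relation.Binary.PropositionalEquality
open import Relation.Nullary using (Dec; yes; no; does; ¬_; ¬?; contradiction)
open import Relation.Nullary.Decidable
  using ( _×-dec_; _⊎-dec_; _→-dec_; map′; True; False; toWitness; toWitnessFalse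
        ; from-yes; from-no; decidable-stable)
open import Relation.Unary using (Pred; Decidable)

open Equivalence using (to; from)
open InducedSubgraph

-- Induced subgraphs and four-vertex patterns.

InducedSubgraph-trans : ∀ {F G H} → InducedSubgraph F G → InducedSubgraph G H → InducedSubgraph F H
InducedSubgraph-trans e f = record
  { embed     = embed f ∘ embed e
  ; injective = injective e ∘ injective f
  ; adjacency = λ u v → mk⇔
      (to (adjacency f _ _) ∘ to (adjacency e u v))
      (from (adjacency e u v) ∘ from (adjacency f _ _))
  }

infix 5 _⇔-dec_
_⇔-dec_ : {A B : Set} → Dec A → Dec B → Dec (A ⇔ B)
a? ⇔-dec b? = map′ (λ (f , g) → mk⇔ f g) (λ e → to e , from e) ((a? →-dec b?) ×-dec (b? →-dec a?))

-- The vertex maps are searched through their codes in `Fin (G.order ^ H.order)`. Decidability later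
-- turns the refutation of `H -free C₆` into an actual embedding.
inducedSubgraph? : ∀ H G → Dec (InducedSubgraph H G)
inducedSubgraph? H G = map′ decode encode (any? {n = G.order ^ H.order} λ i →
    (all? λ u → all? λ v → (finToFun i u ≟ finToFun i v) →-dec (u ≟ v)) ×-dec
    (all? λ u → all? λ v → (u H.~? v) ⇔-dec (finToFun i u G.~? finToFun i v)))
  where
  module G = Graph G
  module H = Graph H

  Code : Fin (G.order ^ H.order) → Set
  Code i = (∀ u v → finToFun i u ≡ finToFun i v → u ≡ v)
         × (∀ u v → (u H.~ v) ⇔ (finToFun i u G.~ finToFun i v))

  decode : ∃ Code → InducedSubgraph H G
  decode (i , inj , adj) = record
    { embed = finToFun i ; injective = inj _ _ ; adjacency = adj }

  encode : InducedSubgraph H G → ∃ Code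
  encode e = funToFin (embed e)
    , (λ u v eq → injective e (trans (sym (≗embed u)) (trans eq (≗embed v))))
    , (λ u v → subst₂ (λ x y → (u H.~ v) ⇔ (x G.~ y)) (sym (≗embed u)) (sym (≗embed v)) (adjacency e u v))
    where ≗embed = finToFun-funToFin (embed e)

module Embedding (P G : Graph) (f : Graph.Vertex P → Graph.Vertex G) where
  private
    module P = Graph P
    module G = Graph G

  -- Stated for one pair and symmetric in it, so that a four-vertex pattern needs only its six
  -- unordered pairs.
  record Faithful (u v : P.Vertex) : Set where
    field
      preserve : u P.~ v → f u G.~ f v
      reflect  : f u G.~ f v → u P.~ v
      inj      : f u ≡ f v → u ≡ v
  open Faithful

  faithful-refl : Reflexive Faithful
  faithful-refl = record
    { preserve = λ u~u → contradiction u~u (P.~-irrefl refl)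
    ; reflect  = λ fu~fu → contradiction fu~fu (G.~-irrefl refl)
    ; inj      = λ _ → refl
    }

  faithful-sym : Symmetric Faithful
  faithful-sym h = record
    { preserve = G.~-sym ∘ preserve h ∘ P.~-sym
    ; reflect  = P.~-sym ∘ reflect h ∘ G.~-sym
    ; inj      = sym ∘ inj h ∘ sym
    }

  edge : ∀ {u v} {_ : True (u P.~? v)} → f u G.~ f v → Faithful u v
  edge {_} {_} {u~v} fu~fv = record
    { preserve = λ _ → fu~fv
    ; reflect  = λ _ → toWitness u~v
    ; inj      = λ fu≡fv → contradiction fu~fv (G.~-irrefl fu≡fv)
    }

  nonEdge : ∀ {u v} {_ : False (u P.~? v)} → ¬ f u G.~ f v → f u ≢ f v → Faithful u v
  nonEdge {_} {_} {u≁v} fu≁fv fu≢fv = record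
    { preserve = λ u~v → contradiction u~v (toWitnessFalse u≁v)
    ; reflect  = λ fu~fv → contradiction fu~fv fu≁fv
    ; inj      = λ fu≡fv → contradiction fu≡fv fu≢fv
    }

  faithful⇒induced : (∀ u v → Faithful u v) → InducedSubgraph P G
  faithful⇒induced h = record
    { embed     = f
    ; injective = inj (h _ _)
    ; adjacency = λ u v → mk⇔ (preserve (h u v)) (reflect (h u v))
    }

symmetric₄ : {R : Rel (Fin 4) 0ℓ} → Reflexive R → Symmetric R →
             R 0F 1F → R 0F 2F → R 0F 3F → R 1F 2F → R 1F 3F → R 2F 3F → ∀ u v → R u v
symmetric₄ rfl sy r₀₁ r₀₂ r₀₃ r₁₂ r₁₃ r₂₃ = λ where
  0F 0F → rfl
  0F 1F → r₀₁
  0F 2F → r₀₂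
  0F 3F → r₀₃
  1F 0F → sy r₀₁
  1F 1F → rfl
  1F 2F → r₁₂
  1F 3F → r₁₃
  2F 0F → sy r₀₂
  2F 1F → sy r₁₂
  2F 2F → rfl
  2F 3F → r₂₃
  3F 0F → sy r₀₃
  3F 1F → sy r₁₃
  3F 2F → sy r₂₃
  3F 3F → rfl

module _ (G : Graph) where
  open Graph G

  private
    distinct : ∀ {x y z} → x ~ z → ¬ y ~ z → x ≢ y
    distinct x~z y≁z refl = y≁z x~z

    quadruple : Vertex → Vertex → Vertex → Vertex → Fin 4 → Vertex
    quadruple a b c d = lookup (a ∷ b ∷ c ∷ d ∷ [])

  induced-P₄ : ∀ {a b c d} → a ~ b → b ~ c → c ~ d → ¬ a ~ c → ¬ a ~ d → ¬ b ~ d →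
               InducedSubgraph (path 4) G
  induced-P₄ {a} {b} {c} {d} ab bc cd ac ad bd = faithful⇒induced (symmetric₄ faithful-refl faithful-sym
      (edge ab) (nonEdge ac (≢-sym (distinct cd ad))) (nonEdge ad (distinct ab (bd ∘ ~-sym)))
      (edge bc) (nonEdge bd (distinct (~-sym ab) (ad ∘ ~-sym))) (edge cd))
    where open Embedding (path 4) G (quadruple a b c d)

  -- In the pattern `a` and `c` have the same neighbours, so `a≢c` has to be assumed; the other
  -- inequalities follow from the adjacencies.
  induced-P₃+P₁ : ∀ {a b c d} → a ~ b → b ~ c → a ≢ c → ¬ a ~ c →
                  ¬ a ~ d → ¬ b ~ d → ¬ c ~ d → InducedSubgraph (path 3 ⊕ path 1) G
  induced-P₃+P₁ {a} {b} {c} {d} ab bc a≢c ac ad bd cd = faithful⇒induced (symmetric₄ faithful-refl faithful-sym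
      (edge ab) (nonEdge ac a≢c) (nonEdge ad (distinct ab (bd ∘ ~-sym)))
      (edge bc) (nonEdge bd (distinct bc (cd ∘ ~-sym)))
      (nonEdge cd (distinct (~-sym bc) (bd ∘ ~-sym))))
    where open Embedding (path 3 ⊕ path 1) G (quadruple a b c d)

  induced-P₂+P₂ : ∀ {a b c d} → a ~ b → c ~ d → ¬ a ~ c → ¬ a ~ d → ¬ b ~ c → ¬ b ~ d →
                  InducedSubgraph (path 2 ⊕ path 2) G
  induced-P₂+P₂ {a} {b} {c} {d} ab cd ac ad bc bd = faithful⇒induced (symmetric₄ faithful-refl faithful-sym
      (edge ab) (nonEdge ac (distinct ab (bc ∘ ~-sym))) (nonEdge ad (distinct ab (bd ∘ ~-sym)))
      (nonEdge bc (distinct (~-sym ab) (ac ∘ ~-sym))) (nonEdge bd (distinct (~-sym ab) (ad ∘ ~-sym)))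
      (edge cd))
    where open Embedding (path 2 ⊕ path 2) G (quadruple a b c d)

-- Frozen colourings.

χ≤ : ∀ {G k} → Colouring G k → χ G ≤ k
χ≤ {G} α = proj₂ (χ-isChromaticNumber G) _ α

module _ {G : Graph} where
  open Graph G
  open Colouring

  Frozen : ∀ {k} → Colouring G k → Set
  Frozen α = ∀ v c → colour α v ≡ c ⊎ ∃[ w ] (v ~ w × colour α w ≡ c)

  frozen? : ∀ {k} (α : Colouring G k) → Dec (Frozen α)
  frozen? α = all? λ v → all? λ c → (colour α v ≟ c) ⊎-dec any? λ w → (v ~? w) ×-dec (colour α w ≟ c)

  -- The new colour of the recoloured vertex already sits on a neighbour, which keeps it.
  frozen-isolated : ∀ {k} (α β : Colouring G k) → Frozen α → ¬ Recolour G α β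
  frozen-isolated α β frz (v , αv≢βv , same) with frz v (colour β v)
  ... | inj₁ αv≡βv = αv≢βv αv≡βv
  ... | inj₂ (w , v~w , αw≡βv) = proper β v w v~w (trans (sym αw≡βv) (same w λ { refl → ~-irrefl refl v~w }))

  -- A walk from the isolated `α` is empty, so `α` would agree with `β⁺`. But `v₀` or a neighbour of
  -- it has the last colour in `α`, and `β⁺` avoids that colour.
  frozen⇒¬mixing : ∀ {k} (α : Colouring G (suc k)) → Frozen α → Colouring G k → Vertex → ¬ Mixing G (suc k)
  frozen⇒¬mixing {k} α frz β v₀ mix with mix α β⁺
    where
    β⁺ : Colouring G (suc k)
    β⁺ = record { colour = inject₁ ∘ colour β ; proper = λ u v u~v → proper β u v u~v ∘ inject₁-injective }
  ... | _ , (_◅_ {j = γ} r _) , _ = frozen-isolated α γ frz r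
  ... | _ , ε , α≗β⁺ with frz v₀ (fromℕ k)
  ...   | inj₁ eq           = fromℕ≢inject₁ (trans (sym eq) (α≗β⁺ v₀))
  ...   | inj₂ (w , _ , eq) = fromℕ≢inject₁ (trans (sym eq) (α≗β⁺ w))

-- The graphs C₆ and G₁₀.

module _ {n : ℕ} (A : Vec (Vec Bool n) n) where
  private
    entry : Fin n → Fin n → Bool
    entry u v = lookup (lookup A u) v

  tableGraph : {_ : True (all? λ u → all? λ v → Bool.T? (entry u v) →-dec Bool.T? (entry v u))}
               {_ : True (all? λ u → ¬? (Bool.T? (entry u u)))} → Graph
  tableGraph {s} {i} = record
    { order    = n
    ; _~_      = λ u v → Bool.T (entry u v)
    ; _~?_     = λ u v → Bool.T? (entry u v)
    ; ~-sym    = toWitness s _ _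
    ; ~-irrefl = λ { refl → toWitness i _ }
    }

pattern ■ = true
pattern □ = false

C₆ : Graph
C₆ = tableGraph
  ( (□ ∷ ■ ∷ □ ∷ □ ∷ □ ∷ ■ ∷ [])
  ∷ (■ ∷ □ ∷ ■ ∷ □ ∷ □ ∷ □ ∷ [])
  ∷ (□ ∷ ■ ∷ □ ∷ ■ ∷ □ ∷ □ ∷ [])
  ∷ (□ ∷ □ ∷ ■ ∷ □ ∷ ■ ∷ □ ∷ [])
  ∷ (□ ∷ □ ∷ □ ∷ ■ ∷ □ ∷ ■ ∷ [])
  ∷ (■ ∷ □ ∷ □ ∷ □ ∷ ■ ∷ □ ∷ [])
  ∷ [])

-- The complement of two triangles 0 1 2 and 3 4 5 joined by the paths 0 3, 1 6 7 4
-- and 2 8 9 5.  The frozen colouring has the path edges meeting a triangle as its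
-- classes, the 4-colouring the two triangles and the edges 6 7 and 8 9.
G₁₀ : Graph
G₁₀ = tableGraph
  ( (□ ∷ □ ∷ □ ∷ □ ∷ ■ ∷ ■ ∷ ■ ∷ ■ ∷ ■ ∷ ■ ∷ [])
  ∷ (□ ∷ □ ∷ □ ∷ ■ ∷ ■ ∷ ■ ∷ □ ∷ ■ ∷ ■ ∷ ■ ∷ [])
  ∷ (□ ∷ □ ∷ □ ∷ ■ ∷ ■ ∷ ■ ∷ ■ ∷ ■ ∷ □ ∷ ■ ∷ [])
  ∷ (□ ∷ ■ ∷ ■ ∷ □ ∷ □ ∷ □ ∷ ■ ∷ ■ ∷ ■ ∷ ■ ∷ [])
  ∷ (■ ∷ ■ ∷ ■ ∷ □ ∷ □ ∷ □ ∷ ■ ∷ □ ∷ ■ ∷ ■ ∷ [])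
  ∷ (■ ∷ ■ ∷ ■ ∷ □ ∷ □ ∷ □ ∷ ■ ∷ ■ ∷ ■ ∷ □ ∷ [])
  ∷ (■ ∷ □ ∷ ■ ∷ ■ ∷ ■ ∷ ■ ∷ □ ∷ □ ∷ ■ ∷ ■ ∷ [])
  ∷ (■ ∷ ■ ∷ ■ ∷ ■ ∷ □ ∷ ■ ∷ □ ∷ □ ∷ ■ ∷ ■ ∷ [])
  ∷ (■ ∷ ■ ∷ □ ∷ ■ ∷ ■ ∷ ■ ∷ ■ ∷ ■ ∷ □ ∷ □ ∷ [])
  ∷ (■ ∷ ■ ∷ ■ ∷ ■ ∷ ■ ∷ □ ∷ ■ ∷ ■ ∷ □ ∷ □ ∷ [])
  ∷ [])

module _ (G : Graph) where
  open Graph G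

  tableColouring : ∀ {k} (cs : Vec (Fin k) order)
    {_ : True (all? λ u → all? λ v → (u ~? v) →-dec ¬? (lookup cs u ≟ lookup cs v))} → Colouring G k
  tableColouring cs {p} = record { colour = lookup cs ; proper = toWitness p }

C₆-¬mixing : ¬ Mixing C₆ 3
C₆-¬mixing = frozen⇒¬mixing {C₆} α (from-yes (frozen? {C₆} α)) β 0F
  where
  -- Antipodal vertices share a colour, so the two neighbours of a vertex have the two colours that
  -- it lacks.
  α = tableColouring C₆ (0F ∷ 1F ∷ 2F ∷ 0F ∷ 1F ∷ 2F ∷ [])
  β = tableColouring C₆ (0F ∷ 1F ∷ 0F ∷ 1F ∷ 0F ∷ 1F ∷ [])

χ-C₆ : χ C₆ ≤ 2
χ-C₆ = χ≤ (tableColouring C₆ (0F ∷ 1F ∷ 0F ∷ 1F ∷ 0F ∷ 1F ∷ []))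

G₁₀-colouring : Colouring G₁₀ 4
G₁₀-colouring = tableColouring G₁₀ (0F ∷ 0F ∷ 0F ∷ 1F ∷ 1F ∷ 1F ∷ 2F ∷ 2F ∷ 3F ∷ 3F ∷ [])

G₁₀-¬mixing : ¬ Mixing G₁₀ 5
G₁₀-¬mixing = frozen⇒¬mixing {G₁₀} α (from-yes (frozen? {G₁₀} α)) G₁₀-colouring 0F
  where
  α = tableColouring G₁₀ (0F ∷ 1F ∷ 3F ∷ 0F ∷ 2F ∷ 4F ∷ 1F ∷ 2F ∷ 3F ∷ 4F ∷ [])

-- In the complement, P₂+P₂ becomes an induced 4-cycle, and the two triangles with their three paths
-- contain none. The proof runs through all pairs of edges.
G₁₀-2P₂-free : path 2 ⊕ path 2 -free G₁₀
G₁₀-2P₂-free e = no2P₂ (embed e 0F) (embed e 1F) (to (adjacency e 0F 1F) (from-yes (0F P.~? 1F)))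
  (embed e 2F) (embed e 3F) (to (adjacency e 2F 3F) (from-yes (2F P.~? 3F)))
  ( from-no (0F P.~? 2F) ∘ from (adjacency e 0F 2F)
  , from-no (0F P.~? 3F) ∘ from (adjacency e 0F 3F)
  , from-no (1F P.~? 2F) ∘ from (adjacency e 1F 2F)
  , from-no (1F P.~? 3F) ∘ from (adjacency e 1F 3F))
  where
  module P = Graph (path 2 ⊕ path 2)
  open Graph G₁₀
  no2P₂ : ∀ a b → a ~ b → ∀ c d → c ~ d → ¬ (¬ a ~ c × ¬ a ~ d × ¬ b ~ c × ¬ b ~ d)
  no2P₂ = from-yes (all? λ a → all? λ b → (a ~? b) →-dec all? λ c → all? λ d → (c ~? d) →-dec
    ¬? (¬? (a ~? c) ×-dec ¬? (a ~? d) ×-dec ¬? (b ~? c) ×-dec ¬? (b ~? d)))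

-- Induced subgraphs of C₆ without P₂+P₂.

private
  module C₆ = Graph C₆

turn : C₆.Vertex → ℕ → C₆.Vertex
turn a k = (toℕ a + k) mod 6

-- The position of `u` when the cycle is numbered from `a`.
turn-back : C₆.Vertex → C₆.Vertex → C₆.Vertex
turn-back a u = (toℕ u + (6 ∸ toℕ a)) mod 6

module _ (P : Graph) where
  private
    module P = Graph P

  EmbedsMinus : (C₆.Vertex → P.Vertex) → Rel C₆.Vertex 0ℓ
  EmbedsMinus φ a b = ∀ u → u ≢ a × u ≢ b → ∀ v → v ≢ a × v ≢ b →
    ((u C₆.~ v) ⇔ (φ u P.~ φ v)) × (φ u ≡ φ v → u ≡ v)

  embedsMinus? : ∀ φ a b → Dec (EmbedsMinus φ a b)
  embedsMinus? φ a b = all? λ u → (¬? (u ≟ a) ×-dec ¬? (u ≟ b)) →-dec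
    all? λ v → (¬? (v ≟ a) ×-dec ¬? (v ≟ b)) →-dec
    ((u C₆.~? v) ⇔-dec (φ u P.~? φ v)) ×-dec ((φ u ≟ φ v) →-dec (u ≟ v))

  induced-C₆-minus : ∀ {H φ a b} (e : InducedSubgraph H C₆) → EmbedsMinus φ a b →
    (∀ u → embed e u ≢ a) → (∀ u → embed e u ≢ b) → InducedSubgraph H P
  induced-C₆-minus {φ = φ} e h ¬a ¬b = record
    { embed     = φ ∘ embed e
    ; injective = λ {u} {v} → injective e ∘ proj₂ (at u v)
    ; adjacency = λ u v → mk⇔ (to (proj₁ (at u v)) ∘ to (adjacency e u v))
                              (from (adjacency e u v) ∘ from (proj₁ (at u v)))
    }
    where at = λ u v → h (embed e u) (¬a u , ¬b u) (embed e v) (¬a v , ¬b v)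

-- The value 0F at the two removed vertices, in positions 0, 1 and 0, 2, is junk.
toP₄ toP₃+P₁ : C₆.Vertex → C₆.Vertex → Fin 4
toP₄    a u = lookup (0F ∷ 0F ∷ 0F ∷ 1F ∷ 2F ∷ 3F ∷ []) (turn-back a u)
toP₃+P₁ a u = lookup (0F ∷ 3F ∷ 0F ∷ 0F ∷ 1F ∷ 2F ∷ []) (turn-back a u)

C₆-minus-edge : ∀ a → EmbedsMinus (path 4) (toP₄ a) a (turn a 1)
C₆-minus-edge = from-yes (all? λ a → embedsMinus? (path 4) (toP₄ a) a (turn a 1))

C₆-minus-nonEdge : ∀ a → EmbedsMinus (path 3 ⊕ path 1) (toP₃+P₁ a) a (turn a 2)
C₆-minus-nonEdge = from-yes (all? λ a → embedsMinus? (path 3 ⊕ path 1) (toP₃+P₁ a) a (turn a 2))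

-- These are the vertices left by `a` and its antipode `turn a 3`. They cannot all be hit by a
-- (P₂+P₂)-free graph, so a missed `a` comes with a second missed vertex at distance one or two.
C₆-2P₂ : ∀ a → turn a 1 C₆.~ turn a 2 × turn a 4 C₆.~ turn a 5 ×
               ¬ turn a 1 C₆.~ turn a 4 × ¬ turn a 1 C₆.~ turn a 5 ×
               ¬ turn a 2 C₆.~ turn a 4 × ¬ turn a 2 C₆.~ turn a 5
C₆-2P₂ = from-yes (all? λ a →
  (turn a 1 C₆.~? turn a 2) ×-dec (turn a 4 C₆.~? turn a 5) ×-dec
  ¬? (turn a 1 C₆.~? turn a 4) ×-dec ¬? (turn a 1 C₆.~? turn a 5) ×-dec
  ¬? (turn a 2 C₆.~? turn a 4) ×-dec ¬? (turn a 2 C₆.~? turn a 5))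

turn-4-2 : ∀ a → turn (turn a 4) 2 ≡ a
turn-4-2 = from-yes (all? λ a → turn (turn a 4) 2 ≟ a)

turn-5-1 : ∀ a → turn (turn a 5) 1 ≡ a
turn-5-1 = from-yes (all? λ a → turn (turn a 5) 1 ≟ a)

module _ {H : Graph} (e : InducedSubgraph H C₆) (2P₂-free : path 2 ⊕ path 2 -free H) where
  private
    module H = Graph H

    Hit : C₆.Vertex → Set
    Hit a = ∃[ u ] embed e u ≡ a

    hit? : ∀ a → Dec (Hit a)
    hit? a = any? λ u → embed e u ≟ a

    ¬hit-2P₂ : ∀ a → Hit (turn a 1) → Hit (turn a 2) → Hit (turn a 4) → ¬ Hit (turn a 5)
    ¬hit-2P₂ a (u₁ , e₁) (u₂ , e₂) (u₄ , e₄) (u₅ , e₅) = let (p , q , r , s , t , w) = C₆-2P₂ a in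
      2P₂-free (induced-P₂+P₂ H {u₁} {u₂} {u₄} {u₅}
        (pull e₁ e₂ p) (pull e₄ e₅ q) (r ∘ push e₁ e₄) (s ∘ push e₁ e₅) (t ∘ push e₂ e₄) (w ∘ push e₂ e₅))
      where
      pull : ∀ {u v x y} → embed e u ≡ x → embed e v ≡ y → x C₆.~ y → u H.~ v
      pull {u} {v} refl refl = from (adjacency e u v)
      push : ∀ {u v x y} → embed e u ≡ x → embed e v ≡ y → u H.~ v → x C₆.~ y
      push {u} {v} refl refl = to (adjacency e u v)

    miss : ∀ {a} → ¬ Hit a → ∀ u → embed e u ≢ a
    miss ¬h u eq = ¬h (u , eq)

    missed : ∃[ a ] ¬ Hit a
    missed with any? (λ a → ¬? (hit? a))
    ... | yes m = m
    ... | no ¬m = contradiction (hit (turn 0F 5)) (¬hit-2P₂ 0F (hit _) (hit _) (hit _))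
      where
      hit : ∀ a → Hit a
      hit a = decidable-stable (hit? a) λ ¬h → ¬m (a , ¬h)

  induced-C₆⇒ : InducedSubgraph H (path 4) ⊎ InducedSubgraph H (path 3 ⊕ path 1)
  induced-C₆⇒ with missed
  ... | a , ¬a with hit? (turn a 1) | hit? (turn a 2) | hit? (turn a 4) | hit? (turn a 5)
  ...   | no ¬1 | _     | _     | _     = inj₁ (induced-C₆-minus (path 4) e (C₆-minus-edge a) (miss ¬a) (miss ¬1))
  ...   | _     | no ¬2 | _     | _     = inj₂ (induced-C₆-minus _ e (C₆-minus-nonEdge a) (miss ¬a) (miss ¬2))
  -- The tables number the cycle forwards from the first removed vertex. Here that is `turn a 4`,
  -- and two steps on it reaches `a`.
  ...   | _     | _     | no ¬4 | _     = inj₂ (induced-C₆-minus _ e (C₆-minus-nonEdge (turn a 4)) (miss ¬4)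
                                            (miss (subst (¬_ ∘ Hit) (sym (turn-4-2 a)) ¬a)))
  ...   | _     | _     | _     | no ¬5 = inj₁ (induced-C₆-minus (path 4) e (C₆-minus-edge (turn a 5)) (miss ¬5)
                                            (miss (subst (¬_ ∘ Hit) (sym (turn-5-1 a)) ¬a)))
  ...   | yes h₁ | yes h₂ | yes h₄ | yes h₅ = contradiction h₅ (¬hit-2P₂ a h₁ h₂ h₄)

mixing⇒induced : (H : Graph) →
  ((G : Graph) → H -free G → (ℓ : ℕ) → ℓ ≥ χ G + 1 → Mixing G ℓ) →
  InducedSubgraph H (path 4) ⊎ InducedSubgraph H (path 3 ⊕ path 1)
mixing⇒induced H mixing = induced-C₆⇒ e 2P₂-free
  where
  e : InducedSubgraph H C₆
  e = decidable-stable (inducedSubgraph? H C₆) λ free → C₆-¬mixing (mixing C₆ free 3 (ℕ.+-monoˡ-≤ 1 χ-C₆))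

  2P₂-free : path 2 ⊕ path 2 -free H
  2P₂-free 2P₂⊆H = G₁₀-¬mixing (mixing G₁₀ (λ H⊆K → G₁₀-2P₂-free (InducedSubgraph-trans 2P₂⊆H H⊆K)) 5
    (ℕ.+-monoˡ-≤ 1 (χ≤ G₁₀-colouring)))

-- Partial colourings and the induction on the number of colours.

punchIn-≤ : ∀ {n} (i : Fin (suc n)) (j : Fin n) → toℕ (punchIn i j) ≤ suc (toℕ j)
punchIn-≤ zero    j       = ℕ.≤-refl
punchIn-≤ (suc i) zero    = z≤n
punchIn-≤ (suc i) (suc j) = s≤s (punchIn-≤ i j)

module _ (G : Graph) where
  open Graph G

  -- The colours of the vertices outside A are irrelevant.
  record Partial (A : Pred Vertex 0ℓ) (k : ℕ) : Set where
    constructor _,ₚ_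
    field
      colour : Vertex → Fin k
      proper : ∀ {u v} → A u → A v → u ~ v → colour u ≢ colour v
  open Partial

  -- Unlike in Recolour, the colour of no vertex of A need change.
  record Step {A k} (α γ : Partial A k) : Set where
    constructor step
    field
      unique : ∀ {u v} → A u → A v → colour α u ≢ colour γ u → colour α v ≢ colour γ v → u ≡ v

  module _ {A : Pred Vertex 0ℓ} {k : ℕ} where

    Step-sym : Symmetric (Step {A} {k})
    Step-sym (step s) = step λ Au Av γu≢αu γv≢αv → s Au Av (≢-sym γu≢αu) (≢-sym γv≢αv)

    agree⇒Step : {α γ : Partial A k} → (∀ {v} → A v → colour α v ≡ colour γ v) → Step α γ
    agree⇒Step same = step λ Au _ αu≢γu _ → contradiction (same Au) αu≢γu

    single⇒Step : {α γ : Partial A k} (v : Vertex) →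
      (∀ {w} → A w → w ≢ v → colour α w ≡ colour γ w) → Step α γ
    single⇒Step {α} {γ} v same = step λ Au Aw αu≢γu αw≢γw → trans (at-v Au αu≢γu) (sym (at-v Aw αw≢γw))
      where
      at-v : ∀ {u} → A u → colour α u ≢ colour γ u → u ≡ v
      at-v {u} Au αu≢γu = decidable-stable (u ≟ v) (αu≢γu ∘ same Au)

    -- Switch the vertices from α to γ one at a time, in numerical order.
    compatible⇒Star : (α γ : Partial A k) →
      (∀ {u v} → A u → A v → u ~ v → colour α u ≢ colour γ v) → Star Step α γ
    -- The first and last hybrids agree with `α` and `γ` on `A` only pointwise, hence a step that
    -- changes nothing at either end.
    compatible⇒Star α γ cross = upTo order ◅◅ (agree⇒Step complete ◅ ε)
      where
      choose : ∀ v {i} → Dec (toℕ v < i) → Fin k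
      choose v (yes _) = colour γ v
      choose v (no _)  = colour α v

      choose-proper : ∀ {u v i} → A u → A v → u ~ v → (u? : Dec (toℕ u < i)) (v? : Dec (toℕ v < i)) →
                      choose u u? ≢ choose v v?
      choose-proper Au Av u~v (yes _) (yes _) = proper γ Au Av u~v
      choose-proper Au Av u~v (yes _) (no _)  = cross Av Au (~-sym u~v) ∘ sym
      choose-proper Au Av u~v (no _)  (yes _) = cross Au Av u~v
      choose-proper Au Av u~v (no _)  (no _)  = proper α Au Av u~v

      hybrid : ℕ → Partial A k
      hybrid i = (λ v → choose v (toℕ v ℕ.<? i)) ,ₚ λ {u} {v} Au Av u~v →
        choose-proper Au Av u~v (toℕ u ℕ.<? i) (toℕ v ℕ.<? i)

      start : ∀ {v} → A v → colour α v ≡ colour (hybrid 0) v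
      start {v} _ with toℕ v ℕ.<? 0
      ... | no _ = refl

      complete : ∀ {v} → A v → colour (hybrid order) v ≡ colour γ v
      complete {v} _ with toℕ v ℕ.<? order
      ... | yes _  = refl
      ... | no v≮n = contradiction (toℕ<n v) v≮n

      advance : ∀ i → Step (hybrid i) (hybrid (suc i))
      advance i = step λ {u} {w} _ _ du dw → toℕ-injective (trans (at-i u du) (sym (at-i w dw)))
        where
        at-i : ∀ v → colour (hybrid i) v ≢ colour (hybrid (suc i)) v → toℕ v ≡ i
        at-i v d with toℕ v ℕ.<? i | toℕ v ℕ.<? suc i
        ... | yes _   | yes _    = contradiction refl d
        ... | yes v<i | no v≮1+i = contradiction (ℕ.m<n⇒m<1+n v<i) v≮1+i
        ... | no v≮i  | yes v<1+i = ℕ.≤-antisym (s≤s⁻¹ v<1+i) (ℕ.≮⇒≥ v≮i)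
        ... | no _    | no _     = contradiction refl d

      upTo : ∀ i → Star Step α (hybrid i)
      upTo zero    = agree⇒Step start ◅ ε
      upTo (suc i) = upTo i ◅◅ (advance i ◅ ε)

  Misses : ∀ {A k} → Partial A k → Fin k → Set
  Misses {A} α f = ∀ {v} → A v → colour α v ≢ f

  -- All that the induction asks of the graph. `A` varies because the induction removes classes of
  -- `β`, and `β` takes values in `ℕ` so that one map serves every number of classes.
  CanFreeColour : Set₁
  CanFreeColour = ∀ {A : Pred Vertex 0ℓ} (A? : Decidable A) {m} (β : Vertex → ℕ) →
    (∀ {v} → A v → β v < m) → (∀ {u v} → A u → A v → u ~ v → β u ≢ β v) →
    (α : Partial A (suc m)) → ∃[ γ ] (Star Step α γ × ∃ (Misses γ))

  module _ (free : CanFreeColour) (β : Vertex → ℕ) (β-proper : ∀ {u v} → u ~ v → β u ≢ β v) where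

    Below : ℕ → Pred Vertex 0ℓ
    Below ℓ v = β v < ℓ

    -- The cap makes the map total; on `Below ℓ` it changes nothing.
    clip : ∀ ℓ → ℕ → Fin (suc ℓ)
    clip ℓ x = fromℕ< (s≤s (ℕ.m⊓n≤n x ℓ))

    toℕ-clip : ∀ {ℓ x} → x < ℓ → toℕ (clip ℓ x) ≡ x
    toℕ-clip {ℓ} x<ℓ = trans (toℕ-fromℕ< _) (ℕ.m≤n⇒m⊓n≡m (ℕ.<⇒≤ x<ℓ))

    clipped : ∀ ℓ → Partial (Below ℓ) (suc ℓ)
    clipped ℓ = (clip ℓ ∘ β) ,ₚ λ u<ℓ v<ℓ u~v eq →
      β-proper u~v (trans (sym (toℕ-clip u<ℓ)) (trans (cong toℕ eq) (toℕ-clip v<ℓ)))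

    module _ {ℓ : ℕ} where

      topped : ∀ {k} (f : Fin k) (g : Vertex → Fin k) (v : Vertex) → Dec (β v ≡ ℓ) → Fin k
      topped f g v (yes _) = f
      topped f g v (no _)  = g v

      top-up : ∀ {k} (f : Fin k) (g : Vertex → Fin k) →
        (∀ {u v} → Below ℓ u → Below ℓ v → u ~ v → g u ≢ g v) →
        (∀ {v} → Below ℓ v → g v ≢ f) → Partial (Below (suc ℓ)) k
      top-up f g g-proper g≢f = (λ v → topped f g v (β v ℕ.≟ ℓ)) ,ₚ
        λ {u} {v} Au Av u~v → go Au Av u~v (β u ℕ.≟ ℓ) (β v ℕ.≟ ℓ)
        where
        go : ∀ {u v} → Below (suc ℓ) u → Below (suc ℓ) v → u ~ v →
             (u? : Dec (β u ≡ ℓ)) (v? : Dec (β v ≡ ℓ)) → topped f g u u? ≢ topped f g v v?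
        go Au Av u~v (yes u≡ℓ) (yes v≡ℓ) = contradiction (trans u≡ℓ (sym v≡ℓ)) (β-proper u~v)
        go Au Av u~v (yes _)   (no v≢ℓ)  = g≢f (ℕ.≤∧≢⇒< (s≤s⁻¹ Av) v≢ℓ) ∘ sym
        go Au Av u~v (no u≢ℓ)  (yes _)   = g≢f (ℕ.≤∧≢⇒< (s≤s⁻¹ Au) u≢ℓ)
        go Au Av u~v (no u≢ℓ)  (no v≢ℓ)  = g-proper (ℕ.≤∧≢⇒< (s≤s⁻¹ Au) u≢ℓ) (ℕ.≤∧≢⇒< (s≤s⁻¹ Av) v≢ℓ) u~v

      -- Puts the removed colour `f` and the removed class `ℓ` back together, undoing `lower`.
      lift : Fin (suc (suc ℓ)) → Partial (Below ℓ) (suc ℓ) → Partial (Below (suc ℓ)) (suc (suc ℓ))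
      lift f α = top-up f (punchIn f ∘ colour α)
        (λ Au Av u~v → proper α Au Av u~v ∘ punchIn-injective f _ _) (λ _ → punchInᵢ≢i f _)

      lift-Step : ∀ f {α γ} → Step α γ → Step (lift f α) (lift f γ)
      lift-Step f {α} {γ} (step s) = step go
        where
        go : ∀ {u v} → Below (suc ℓ) u → Below (suc ℓ) v → colour (lift f α) u ≢ colour (lift f γ) u →
             colour (lift f α) v ≢ colour (lift f γ) v → u ≡ v
        go {u} {v} Au Av du dv with β u ℕ.≟ ℓ | β v ℕ.≟ ℓ
        ... | yes _  | _      = contradiction refl du
        ... | no _   | yes _  = contradiction refl dv
        ... | no u≢ℓ | no v≢ℓ = s (ℕ.≤∧≢⇒< (s≤s⁻¹ Au) u≢ℓ) (ℕ.≤∧≢⇒< (s≤s⁻¹ Av) v≢ℓ)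
          (du ∘ cong (punchIn f)) (dv ∘ cong (punchIn f))

      recolour-top : ∀ {k} (α : Partial (Below (suc ℓ)) k) {f} → Misses α f → Partial (Below (suc ℓ)) k
      recolour-top α {f} m = top-up f (colour α)
        (λ Au Av → proper α (ℕ.m<n⇒m<1+n Au) (ℕ.m<n⇒m<1+n Av)) (m ∘ ℕ.m<n⇒m<1+n)

      recolour-top-Star : ∀ {k} (α : Partial (Below (suc ℓ)) k) {f} (m : Misses α f) →
        Star Step α (recolour-top α m)
      recolour-top-Star α {f} m = compatible⇒Star α (recolour-top α m)
        (λ {_} {v} Au Av u~v → cross Au Av u~v (β v ℕ.≟ ℓ))
        where
        cross : ∀ {u v} → Below (suc ℓ) u → Below (suc ℓ) v → u ~ v → (v? : Dec (β v ≡ ℓ)) →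
                colour α u ≢ topped f (colour α) v v?
        cross Au Av u~v (yes _) = m Au
        cross Au Av u~v (no _)  = proper α Au Av u~v

      -- Class `ℓ` of `β` and colour `f` of `α` are the same set of vertices, so removing both
      -- leaves one class and one colour fewer.
      record Anchored (f : Fin (suc (suc ℓ))) (α : Partial (Below (suc ℓ)) (suc (suc ℓ))) : Set where
        field
          top  : ∀ {v} → β v ≡ ℓ → colour α v ≡ f
          rest : ∀ {v} → Below ℓ v → colour α v ≢ f
      open Anchored

      top-up-anchored : ∀ f (g : Vertex → Fin (suc (suc ℓ)))
        (p : ∀ {u v} → Below ℓ u → Below ℓ v → u ~ v → g u ≢ g v)
        (q : ∀ {v} → Below ℓ v → g v ≢ f) → Anchored f (top-up f g p q)
      top-up-anchored f g _ q = record { top = top′ ; rest = rest′ }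
        where
        top′ : ∀ {v} → β v ≡ ℓ → topped f g v (β v ℕ.≟ ℓ) ≡ f
        top′ {v} v≡ℓ with β v ℕ.≟ ℓ
        ... | yes _  = refl
        ... | no v≢ℓ = contradiction v≡ℓ v≢ℓ
        rest′ : ∀ {v} → Below ℓ v → topped f g v (β v ℕ.≟ ℓ) ≢ f
        rest′ {v} v<ℓ with β v ℕ.≟ ℓ
        ... | yes v≡ℓ = contradiction v≡ℓ (ℕ.<⇒≢ v<ℓ)
        ... | no _    = q v<ℓ

      lift-anchored : ∀ f α → Anchored f (lift f α)
      lift-anchored f α = top-up-anchored f (punchIn f ∘ colour α)
        (λ Au Av u~v → proper α Au Av u~v ∘ punchIn-injective f _ _) (λ _ → punchInᵢ≢i f _)

      recolour-top-anchored : ∀ α {f} (m : Misses α f) → Anchored f (recolour-top α m)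
      recolour-top-anchored α {f} m = top-up-anchored f (colour α)
        (λ Au Av → proper α (ℕ.m<n⇒m<1+n Au) (ℕ.m<n⇒m<1+n Av)) (m ∘ ℕ.m<n⇒m<1+n)

      -- The value at f itself is junk.
      squash : ∀ (f x : Fin (suc (suc ℓ))) → Fin (suc ℓ)
      squash f x with f ≟ x
      ... | yes _  = zero
      ... | no f≢x = punchOut f≢x

      punchIn-squash : ∀ {f x} → x ≢ f → punchIn f (squash f x) ≡ x
      punchIn-squash {f} {x} x≢f with f ≟ x
      ... | yes f≡x = contradiction (sym f≡x) x≢f
      ... | no f≢x  = punchIn-punchOut f≢x

      lower : ∀ {f α} → Anchored f α → Partial (Below ℓ) (suc ℓ)
      lower {f} {α} a = (squash f ∘ colour α) ,ₚ λ Au Av u~v eq →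
        proper α (ℕ.m<n⇒m<1+n Au) (ℕ.m<n⇒m<1+n Av) u~v
          (trans (sym (punchIn-squash (rest a Au))) (trans (cong (punchIn f) eq) (punchIn-squash (rest a Av))))

      lift-lower : ∀ {f α} (a : Anchored f α) {v} → Below (suc ℓ) v →
                   colour (lift f (lower a)) v ≡ colour α v
      lift-lower a {v} Av with β v ℕ.≟ ℓ
      ... | yes v≡ℓ = sym (top a v≡ℓ)
      ... | no v≢ℓ  = punchIn-squash (rest a (ℕ.≤∧≢⇒< (s≤s⁻¹ Av) v≢ℓ))

      module _ (IH : (α γ : Partial (Below ℓ) (suc ℓ)) → Star Step α γ) where

        -- The hypothesis `IH` links the two colourings once class `ℓ` and colour `f` are removed,
        -- and lifting that walk keeps the class at `f`. The outer steps only replace a colouring by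
        -- a pointwise equal one.
        anchored-linked : ∀ {f α γ} → Anchored f α → Anchored f γ → Star Step α γ
        anchored-linked {f} a c = agree⇒Step (sym ∘ lift-lower a)
          ◅ gmap (lift f) (lift-Step f) (IH (lower a) (lower c))
          ◅◅ (agree⇒Step (lift-lower c) ◅ ε)

        last : Fin (suc (suc ℓ))
        last = fromℕ (suc ℓ)

        reach-anchored : (α : Partial (Below (suc ℓ)) (suc (suc ℓ))) →
                         ∃[ γ ] (Star Step α γ × Anchored last γ)
        reach-anchored α with free (λ v → β v ℕ.<? suc ℓ) β (λ v<1+ℓ → v<1+ℓ) (λ _ _ → β-proper) α
        ... | γ , α→γ , f , γ-misses with f ≟ last
        ...   | yes refl  = recolour-top γ γ-misses
              , α→γ ◅◅ recolour-top-Star γ γ-misses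
              , recolour-top-anchored γ γ-misses
        ...   | no f≢last = recolour-top δ δ-misses
              , α→γ ◅◅ recolour-top-Star γ γ-misses
                    ◅◅ anchored-linked (recolour-top-anchored γ γ-misses) (lift-anchored f (clipped ℓ))
                    ◅◅ recolour-top-Star δ δ-misses
              , recolour-top-anchored δ δ-misses
          where
          -- Below `ℓ` this is `β` with its colours shifted up by at most one to make room for `f`;
          -- they stay at most `ℓ`, while `last` is `suc ℓ`.
          δ = lift f (clipped ℓ)

          δ-misses : Misses δ last
          δ-misses {v} v<1+ℓ with β v ℕ.≟ ℓ
          ... | yes _  = f≢last
          ... | no v≢ℓ = λ eq → ℕ.<⇒≱ v<ℓ (s≤s⁻¹ (begin
              suc ℓ                                   ≡⟨ toℕ-fromℕ (suc ℓ) ⟨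
              toℕ last                                ≡⟨ cong toℕ eq ⟨
              toℕ (punchIn f (clip ℓ (β v)))          ≤⟨ punchIn-≤ f (clip ℓ (β v)) ⟩
              suc (toℕ (clip ℓ (β v)))                ≡⟨ cong suc (toℕ-clip v<ℓ) ⟩
              suc (β v)                               ∎))
            where
            v<ℓ = ℕ.≤∧≢⇒< (s≤s⁻¹ v<1+ℓ) v≢ℓ
            open ℕ.≤-Reasoning

    -- Induction on the number of classes of `β`: both colourings reach one anchored at the same
    -- colour `last`, and steps are reversible. With no classes there are no relevant vertices.
    linked : ∀ ℓ (α γ : Partial (Below ℓ) (suc ℓ)) → Star Step α γ
    linked zero    α γ = step (λ ()) ◅ ε
    linked (suc ℓ) α γ =
      let (α′ , α→α′ , a) = reach-anchored (linked ℓ) α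
          (γ′ , γ→γ′ , c) = reach-anchored (linked ℓ) γ
      in α→α′ ◅◅ anchored-linked (linked ℓ) a c ◅◅ reverse Step-sym γ→γ′

-- Sums, a pigeonhole principle and indicators.

sum-mono-≤ : ∀ {n} {f g : Fin n → ℕ} → (∀ i → f i ≤ g i) → sum f ≤ sum g
sum-mono-≤ {zero}  f≤g = z≤n
sum-mono-≤ {suc n} f≤g = ℕ.+-mono-≤ (f≤g zero) (sum-mono-≤ (f≤g ∘ suc))

sum-mono-< : ∀ {n} {f g : Fin n → ℕ} → (∀ i → f i ≤ g i) → ∀ i → f i < g i → sum f < sum g
sum-mono-< f≤g zero    f<g = ℕ.+-mono-<-≤ f<g (sum-mono-≤ (f≤g ∘ suc))
sum-mono-< f≤g (suc i) f<g = ℕ.+-mono-≤-< (f≤g zero) (sum-mono-< (f≤g ∘ suc) i f<g)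

no-injection-×2 : ∀ {m} (code : Fin (suc m) → Fin 2 → Fin m × Fin 2) →
  -- `suc m * 2` computes to `2 + m * 2`, which exceeds `m * 2`.
  ¬ (∀ f i g j → code f i ≡ code g j → f ≡ g × i ≡ j)
no-injection-×2 {m} code inj = <⇒notInjective (ℕ.m≤n+m (suc (m * 2)) 1) λ {x} {y} → flat-injective x y
  where
  flat : Fin (suc m * 2) → Fin (m * 2)
  flat x = uncurry combine (uncurry code (remQuot {suc m} 2 x))

  pair-injective : ∀ p q → uncurry combine (uncurry code p) ≡ uncurry combine (uncurry code q) → p ≡ q
  pair-injective (f , i) (g , j) eq with e₁ , e₂ ← combine-injective {m} _ _ _ _ eq =
    uncurry (cong₂ _,_) (inj f i g j (cong₂ _,_ e₁ e₂))

  flat-injective : ∀ x y → flat x ≡ flat y → x ≡ y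
  flat-injective x y eq = begin
    x                         ≡⟨ combine-remQuot {suc m} 2 x ⟨
    uncurry combine (split x) ≡⟨ cong (uncurry combine) (pair-injective (split x) (split y) eq) ⟩
    uncurry combine (split y) ≡⟨ combine-remQuot {suc m} 2 y ⟩
    y                         ∎
    where
    open ≡-Reasoning
    split = remQuot {suc m} 2

indicator : {P : Set} → Dec P → ℕ
indicator (yes _) = 1
indicator (no _)  = 0

indicator-mono : {P Q : Set} → (P → Q) → (p? : Dec P) (q? : Dec Q) → indicator p? ≤ indicator q?
indicator-mono P⇒Q (yes p) (yes q) = ℕ.≤-refl
indicator-mono P⇒Q (yes p) (no ¬q) = contradiction (P⇒Q p) ¬q
indicator-mono P⇒Q (no ¬p) _       = z≤n

indicator-< : {P Q : Set} → ¬ P → Q → (p? : Dec P) (q? : Dec Q) → indicator p? < indicator q?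
indicator-< ¬p q (yes p) _       = contradiction p ¬p
indicator-< ¬p q (no _)  (yes _) = ℕ.≤-refl
indicator-< ¬p q (no _)  (no ¬q) = contradiction q ¬q

-- Splits, and the moves that lower a potential.

record Split (G : Graph) : Set₁ where
  open Graph G
  field
    T         : Pred Vertex 0ℓ
    T?        : Decidable T
    joined    : ∀ {u v} → T u → ¬ T v → u ~ v
    no-P₄     : ∀ {a b c d} → T a → T b → T c → T d →
                a ~ b → b ~ c → c ~ d → ¬ a ~ c → ¬ a ~ d → ¬ b ~ d → ⊥
    no-triple : ∀ {a b c} → ¬ T a → ¬ T b → ¬ T c → a ≢ b → a ≢ c → b ≢ c →
                ¬ a ~ b → ¬ a ~ c → ¬ b ~ c → ⊥

module _ {G : Graph} (split : Split G) where
  open Graph G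
  open Split split

  module _ {A : Pred Vertex 0ℓ} (A? : Decidable A) {m : ℕ} (β : Vertex → ℕ)
           (β<m : ∀ {v} → A v → β v < m) (β-proper : ∀ {u v} → A u → A v → u ~ v → β u ≢ β v) where

    private
      Col : Set
      Col = Partial G A (suc m)
      open Partial

    same-side : ∀ {u v} → A u → A v → ¬ T u → β u ≡ β v → ¬ T v
    same-side Au Av ¬Tu βu≡βv Tv = β-proper Av Au (joined Tv ¬Tu) (sym βu≡βv)

    -- Outside `T` a class of `β` has at most two vertices, since three would be an independent
    -- triple.
    partner-unique : ∀ {u v w} → A u → A v → A w → ¬ T u → β u ≡ β v → β u ≡ β w → u ≢ v → u ≢ w → v ≡ w
    partner-unique {u} {v} {w} Au Av Aw ¬Tu βu≡βv βu≡βw u≢v u≢w = decidable-stable (v ≟ w) λ v≢w →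
      no-triple ¬Tu (same-side Au Av ¬Tu βu≡βv) (same-side Au Aw ¬Tu βu≡βw) u≢v u≢w v≢w
        (λ u~v → β-proper Au Av u~v βu≡βv) (λ u~w → β-proper Au Aw u~w βu≡βw)
        (λ v~w → β-proper Av Aw v~w (trans (sym βu≡βv) βu≡βw))

    Torn : Col → Vertex → Set
    Torn α v = ∃[ w ] (A w × ¬ T w × β w ≡ β v × colour α w ≢ colour α v)

    torn? : ∀ α v → Dec (Torn α v)
    torn? α v = any? λ w → A? w ×-dec ¬? (T? w) ×-dec (β w ℕ.≟ β v) ×-dec ¬? (colour α w ≟ colour α v)

    -- The potential: colours count on `T`, where a move lowers one, and torn vertices count outside
    -- `T`, where a move mends a pair. The decisions are arguments so that proofs can split on them.
    costAt : Col → (v : Vertex) → Dec (A v) → Dec (T v) → ℕ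
    costAt α v (no _)  _       = 0
    costAt α v (yes _) (yes _) = toℕ (colour α v)
    costAt α v (yes _) (no _)  = indicator (torn? α v)

    cost : Col → Vertex → ℕ
    cost α v = costAt α v (A? v) (T? v)

    total : Col → ℕ
    total α = sum (cost α)

    module _ {α γ : Col}
      (on-T : ∀ {v} → A v → T v → toℕ (colour γ v) ≤ toℕ (colour α v))
      (off-T : ∀ {v} → A v → ¬ T v → Torn γ v → Torn α v) where

      cost-≤ : ∀ v → cost γ v ≤ cost α v
      cost-≤ v = go (A? v) (T? v)
        where
        go : ∀ a? t? → costAt γ v a? t? ≤ costAt α v a? t?
        go (no _)   _        = z≤n
        go (yes Av) (yes Tv) = on-T Av Tv
        go (yes Av) (no ¬Tv) = indicator-mono (off-T Av ¬Tv) (torn? γ v) (torn? α v)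

      total-<-on-T : ∀ {v} → A v → T v → toℕ (colour γ v) < toℕ (colour α v) → total γ < total α
      total-<-on-T {v} Av Tv γv<αv = sum-mono-< cost-≤ v (go (A? v) (T? v))
        where
        go : ∀ a? t? → costAt γ v a? t? < costAt α v a? t?
        go (no ¬Av) _        = contradiction Av ¬Av
        go (yes _)  (yes _)  = γv<αv
        go (yes _)  (no ¬Tv) = contradiction Tv ¬Tv

      total-<-off-T : ∀ {v} → A v → ¬ T v → ¬ Torn γ v → Torn α v → total γ < total α
      total-<-off-T {v} Av ¬Tv ¬torn torn = sum-mono-< cost-≤ v (go (A? v) (T? v))
        where
        go : ∀ a? t? → costAt γ v a? t? < costAt α v a? t?
        go (no ¬Av) _        = contradiction Av ¬Av
        go (yes _)  (yes Tv) = contradiction Tv ¬Tv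
        go (yes _)  (no _)   = indicator-< ¬torn torn (torn? γ v) (torn? α v)

    Improvement : Col → Set
    Improvement α = ∃[ γ ] (Step G α γ × total γ < total α)

    module _ (α : Col) (y : Vertex) (c : Fin (suc m))
             (free : ∀ {w} → A w → y ~ w → colour α w ≢ c) where

      recoloured : Vertex → Fin (suc m)
      recoloured = updateAt (colour α) y (const c)

      recoloured-at : recoloured y ≡ c
      recoloured-at = updateAt-updates y (colour α)

      recoloured-off : ∀ {v} → v ≢ y → recoloured v ≡ colour α v
      recoloured-off v≢y = updateAt-minimal _ y (colour α) v≢y

      recolour : Col
      recolour = recoloured ,ₚ go
        where
        go : ∀ {u v} → A u → A v → u ~ v → recoloured u ≢ recoloured v
        go {u} {v} Au Av u~v eq with u ≟ y | v ≟ y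
        ... | yes refl | yes refl = ~-irrefl refl u~v
        ... | yes refl | no v≢y   = free Av u~v (trans (sym (recoloured-off v≢y)) (trans (sym eq) recoloured-at))
        ... | no u≢y   | yes refl = free Au (~-sym u~v) (trans (sym (recoloured-off u≢y)) (trans eq recoloured-at))
        ... | no u≢y   | no v≢y   = proper α Au Av u~v (trans (sym (recoloured-off u≢y)) (trans eq (recoloured-off v≢y)))

      recolour-Step : Step G α recolour
      recolour-Step = single⇒Step G {α = α} {recolour} y λ _ w≢y → sym (recoloured-off w≢y)

    lower-on-T : ∀ α {v d} → A v → T v → toℕ d < toℕ (colour α v) →
      (∀ {w} → A w → v ~ w → colour α w ≢ d) → Improvement α
    lower-on-T α {y} {d} Ay Ty d<αy free = γ , recolour-Step α y d free
      , total-<-on-T {α} {γ} on-T off-T Ay Ty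
          (subst (λ c → toℕ c < toℕ (colour α y)) (sym (recoloured-at α y d free)) d<αy)
      where
      γ = recolour α y d free
      off = recoloured-off α y d free

      on-T : ∀ {v} → A v → T v → toℕ (colour γ v) ≤ toℕ (colour α v)
      on-T {v} _ _ with v ≟ y
      ... | yes refl = ℕ.≤-trans (ℕ.≤-reflexive (cong toℕ (recoloured-at α y d free))) (ℕ.<⇒≤ d<αy)
      ... | no v≢y   = ℕ.≤-reflexive (cong toℕ (off v≢y))

      off-T : ∀ {v} → A v → ¬ T v → Torn γ v → Torn α v
      off-T {v} _ ¬Tv (w , Aw , ¬Tw , βw≡βv , γw≢γv) = w , Aw , ¬Tw , βw≡βv
        , λ αw≡αv → γw≢γv (trans (off λ { refl → ¬Tw Ty }) (trans αw≡αv (sym (off λ { refl → ¬Tv Ty }))))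

    Lone : Col → Vertex → Set
    Lone α x = ∀ w → A w → colour α w ≡ colour α x → w ≡ x

    -- `y` may take the colour of `x`, because only `x` has it and `x`, `y` are not adjacent. The
    -- one class of `β` affected is the pair of `x` and `y`, which is mended, and `T` is untouched.
    merge-off-T : ∀ α {x y} → A x → A y → ¬ T y → β x ≡ β y → x ≢ y → Lone α x → Improvement α
    merge-off-T α {x} {y} Ax Ay ¬Ty βx≡βy x≢y lone = γ , recolour-Step α y c free
      , total-<-off-T {α} {γ} on-T off-T Ay ¬Ty mended
          (x , Ax , ¬Tx , βx≡βy , λ αx≡αy → x≢y (sym (lone y Ay (sym αx≡αy))))
      where
      c = colour α x
      ¬Tx = same-side Ay Ax ¬Ty (sym βx≡βy)

      free : ∀ {w} → A w → y ~ w → colour α w ≢ c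
      free {w} Aw y~w αw≡αx with refl ← lone w Aw αw≡αx = β-proper Ay Ax y~w (sym βx≡βy)

      γ = recolour α y c free
      off = recoloured-off α y c free

      agree-xy : colour γ x ≡ colour γ y
      agree-xy = trans (off x≢y) (sym (recoloured-at α y c free))

      mended : ¬ Torn γ y
      mended (w , Aw , ¬Tw , βw≡βy , γw≢γy) = γw≢γy (subst (λ w → colour γ w ≡ colour γ y) x≡w agree-xy)
        where
        x≡w : x ≡ w
        x≡w = partner-unique Ay Ax Aw ¬Ty (sym βx≡βy) (sym βw≡βy) (≢-sym x≢y) λ { refl → γw≢γy refl }

      on-T : ∀ {v} → A v → T v → toℕ (colour γ v) ≤ toℕ (colour α v)
      on-T Av Tv = ℕ.≤-reflexive (cong toℕ (off λ { refl → ¬Ty Tv }))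

      off-T : ∀ {v} → A v → ¬ T v → Torn γ v → Torn α v
      off-T {v} Av ¬Tv torn@(w , Aw , ¬Tw , βw≡βv , γw≢γv) with v ≟ y | w ≟ y
      ... | yes refl | _        = contradiction torn mended
      ... | no v≢y   | yes refl = contradiction (subst (λ v → colour γ y ≡ colour γ v) x≡v (sym agree-xy)) γw≢γv
        where
        x≡v : x ≡ v
        x≡v = partner-unique Ay Ax Av ¬Ty (sym βx≡βy) βw≡βv (≢-sym x≢y) (≢-sym v≢y)
      ... | no v≢y   | no w≢y   = w , Aw , ¬Tw , βw≡βv
        , λ αw≡αv → γw≢γv (trans (off w≢y) (trans αw≡αv (sym (off v≢y))))

    -- The contradiction when no colour is missing and no move applies.

    module Stuck (α : Col)
      (onto : ∀ f → ∃[ v ] (A v × colour α v ≡ f))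
      (greedy : ∀ {v d} → A v → T v → toℕ d < toℕ (colour α v) → ∃[ w ] (A w × v ~ w × colour α w ≡ d))
      (lone-unique : ∀ {x y} → A x → A y → ¬ T y → β x ≡ β y → Lone α x → x ≡ y) where

      OnT : Fin (suc m) → Set
      OnT f = ∃[ v ] (A v × T v × colour α v ≡ f)

      onT? : ∀ f → Dec (OnT f)
      onT? f = any? λ v → A? v ×-dec T? v ×-dec (colour α v ≟ f)

      -- By `joined`, a vertex of colour `f` outside `T` would be adjacent to one inside.
      onT-T : ∀ {f} → OnT f → ∀ {v} → A v → colour α v ≡ f → T v
      onT-T (t , At , Tt , αt≡f) {v} Av αv≡f = decidable-stable (T? v) λ ¬Tv →
        proper α At Av (joined Tt ¬Tv) (trans αt≡f (sym αv≡f))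

      -- A clique with one vertex for each colour from `j` upwards that occurs on `T`; other values
      -- of `rep` are junk. It grows downwards because `greedy` supplies neighbours of smaller
      -- colour only.
      record Clique (j : ℕ) : Set where
        field
          rep      : Fin (suc m) → Vertex
          inA      : ∀ {f} → j ≤ toℕ f → OnT f → A (rep f)
          hue      : ∀ {f} → j ≤ toℕ f → OnT f → colour α (rep f) ≡ f
          adjacent : ∀ {f g} → j ≤ toℕ f → toℕ f < toℕ g → OnT f → OnT g → rep f ~ rep g
      open Clique

      module _ {j : ℕ} (K : Clique (suc j)) {c : Fin (suc m)} (c≡j : toℕ c ≡ j) (onT : OnT c) where

        Dominates : ℕ → Vertex → Set
        Dominates i w = ∀ {f} → toℕ f < i → j < toℕ f → OnT f → w ~ rep K f

        -- The neighbourhoods in the clique of two vertices of colour c are nested: otherwise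
        -- they and two vertices of the clique would induce a P₄.
        dominating : ∀ i → i ≤ suc m → ∃[ w ] (A w × colour α w ≡ c × Dominates i w)
        dominating zero    _    = let (v , Av , _ , αv≡c) = onT in v , Av , αv≡c , λ ()
        dominating (suc i) i<1+m with dominating i (ℕ.<⇒≤ i<1+m)
        ... | w , Aw , αw≡c , dom = go (j ℕ.<? i) (onT? f) (w ~? rep K f)
          where
          f = fromℕ< i<1+m

          f≡i : toℕ f ≡ i
          f≡i = toℕ-fromℕ< i<1+m

          last-case : ∀ {g} → toℕ g < suc i → toℕ g < i ⊎ g ≡ f
          last-case {g} g<1+i with toℕ g ℕ.<? i
          ... | yes g<i = inj₁ g<i
          ... | no g≮i  = inj₂ (toℕ-injective (trans (ℕ.≤-antisym (s≤s⁻¹ g<1+i) (ℕ.≮⇒≥ g≮i)) (sym f≡i)))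

          extend : ∀ {w} → Dominates i w → (j < toℕ f → OnT f → w ~ rep K f) → Dominates (suc i) w
          extend dom new g<1+i j<g onT-g with last-case g<1+i
          ... | inj₁ g<i  = dom g<i j<g onT-g
          ... | inj₂ refl = new j<g onT-g

          go : Dec (j < i) → Dec (OnT f) → Dec (w ~ rep K f) →
               ∃[ w ] (A w × colour α w ≡ c × Dominates (suc i) w)
          go (no j≮i) _ _ = w , Aw , αw≡c , extend dom λ j<f _ → contradiction (subst (j <_) f≡i j<f) j≮i
          go _ (no ¬onT-f) _ = w , Aw , αw≡c , extend dom λ _ onT-f → contradiction onT-f ¬onT-f
          go _ _ (yes w~Kf) = w , Aw , αw≡c , extend dom λ _ _ → w~Kf
          go (yes j<i) (yes onT-f) (no w≁Kf) = switch (greedy AKf TKf c<αKf)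
            where
            j<f = subst (j <_) (sym f≡i) j<i
            AKf = inA K j<f onT-f
            TKf = onT-T onT-f AKf (hue K j<f onT-f)
            c<αKf = subst₂ _<_ (sym c≡j) (cong toℕ (sym (hue K j<f onT-f))) j<f

            switch : ∃[ w′ ] (A w′ × rep K f ~ w′ × colour α w′ ≡ c) →
                     ∃[ w ] (A w × colour α w ≡ c × Dominates (suc i) w)
            switch (w′ , Aw′ , Kf~w′ , αw′≡c) = w′ , Aw′ , αw′≡c , extend old λ _ _ → ~-sym Kf~w′
              where
              old : Dominates i w′
              old {g} g<i j<g onT-g = decidable-stable (w′ ~? rep K g) λ w′≁Kg →
                no-P₄ (onT-T onT Aw αw≡c) (onT-T onT-g (inA K j<g onT-g) (hue K j<g onT-g)) TKf (onT-T onT Aw′ αw′≡c)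
                  (dom g<i j<g onT-g) (adjacent K j<g (subst (toℕ g <_) (sym f≡i) g<i) onT-g onT-f) Kf~w′
                  w≁Kf (λ w~w′ → proper α Aw Aw′ w~w′ (trans αw≡c (sym αw′≡c))) (w′≁Kg ∘ ~-sym)

      clique-step : ∀ {j} → j < suc m → Clique (suc j) → Clique j
      clique-step {j} j<1+m K = go (onT? c)
        where
        c = fromℕ< j<1+m

        c≡j : toℕ c ≡ j
        c≡j = toℕ-fromℕ< j<1+m

        above : ∀ {f} → j ≤ toℕ f → f ≢ c → j < toℕ f
        above j≤f f≢c = ℕ.≤∧≢⇒< j≤f λ j≡f → f≢c (toℕ-injective (trans (sym j≡f) (sym c≡j)))

        go : Dec (OnT c) → Clique j
        go (no ¬onT) = record
          { rep      = rep K
          ; inA      = λ j≤f onT-f → inA K (above j≤f λ { refl → ¬onT onT-f }) onT-f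
          ; hue      = λ j≤f onT-f → hue K (above j≤f λ { refl → ¬onT onT-f }) onT-f
          ; adjacent = λ j≤f f<g onT-f → adjacent K (above j≤f λ { refl → ¬onT onT-f }) f<g onT-f
          }
        go (yes onT) with w , Aw , αw≡c , dom ← dominating K c≡j onT (suc m) ℕ.≤-refl = record
          { rep      = rep′
          ; inA      = inA′
          ; hue      = hue′
          ; adjacent = adjacent′
          }
          where
          rep′ : Fin (suc m) → Vertex
          rep′ = updateAt (rep K) c (const w)

          at : rep′ c ≡ w
          at = updateAt-updates c (rep K)

          off : ∀ {f} → f ≢ c → rep′ f ≡ rep K f
          off f≢c = updateAt-minimal _ c (rep K) f≢c

          inA′ : ∀ {f} → j ≤ toℕ f → OnT f → A (rep′ f)
          inA′ {f} j≤f onT-f with f ≟ c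
          ... | yes refl = subst A (sym at) Aw
          ... | no f≢c   = subst A (sym (off f≢c)) (inA K (above j≤f f≢c) onT-f)

          hue′ : ∀ {f} → j ≤ toℕ f → OnT f → colour α (rep′ f) ≡ f
          hue′ {f} j≤f onT-f with f ≟ c
          ... | yes refl = trans (cong (colour α) at) αw≡c
          ... | no f≢c   = trans (cong (colour α) (off f≢c)) (hue K (above j≤f f≢c) onT-f)

          adjacent′ : ∀ {f g} → j ≤ toℕ f → toℕ f < toℕ g → OnT f → OnT g → rep′ f ~ rep′ g
          adjacent′ {f} {g} j≤f f<g onT-f onT-g with f ≟ c
          ... | yes refl = subst₂ _~_ (sym at) (sym (off λ { refl → ℕ.<-irrefl refl f<g }))
                             (dom (toℕ<n g) (subst (_< toℕ g) c≡j f<g) onT-g)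
          ... | no f≢c   = subst₂ _~_ (sym (off f≢c))
                             (sym (off λ { refl → ℕ.<⇒≱ f<g (subst (_≤ toℕ f) (sym c≡j) j≤f) }))
                             (adjacent K (above j≤f f≢c) f<g onT-f onT-g)

      clique-from : ∀ i {j} → i + j ≡ suc m → Clique j
      clique-from zero    refl = record
        -- No colour is as large as `suc m`, so any vertex will do, and `onto zero` provides one.
        { rep      = const (proj₁ (onto zero))
        ; inA      = λ m<f → contradiction m<f (ℕ.<⇒≱ (toℕ<n _))
        ; hue      = λ m<f → contradiction m<f (ℕ.<⇒≱ (toℕ<n _))
        ; adjacent = λ m<f → contradiction m<f (ℕ.<⇒≱ (toℕ<n _))
        }
      clique-from (suc i) {j} 1+i+j≡1+m = clique-step (subst (suc j ≤_) 1+i+j≡1+m (s≤s (ℕ.m≤n+m j i)))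
        (clique-from i (trans (ℕ.+-suc i j) 1+i+j≡1+m))

      K : Clique 0
      K = clique-from (suc m) (ℕ.+-identityʳ (suc m))

      Second : Pred Vertex 0ℓ
      Second v = ∃[ u ] (A u × β u ≡ β v × toℕ u < toℕ v)

      second? : Decidable Second
      second? v = any? λ u → A? u ×-dec (β u ℕ.≟ β v) ×-dec (toℕ u ℕ.<? toℕ v)

      rank : Vertex → Fin 2
      rank v = if does (second? v) then 1F else 0F

      -- `u` makes `v` second. Were `u` second too, a third vertex of the class would precede it,
      -- against `partner-unique`.
      rank-≢ : ∀ {u v} → A u → A v → ¬ T u → β u ≡ β v → toℕ u < toℕ v → rank u ≢ rank v
      rank-≢ {u} {v} Au Av ¬Tu βu≡βv u<v with second? u | second? v
      ... | _     | no ¬second = contradiction (u , Au , βu≡βv , u<v) ¬second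
      ... | no _  | yes _      = λ ()
      ... | yes (w , Aw , βw≡βu , w<u) | yes _ = contradiction
        (partner-unique Au Av Aw ¬Tu βu≡βv (sym βw≡βu)
          (λ { refl → ℕ.<-irrefl refl u<v })
          (λ { refl → ℕ.<-irrefl refl w<u }))
        (λ { refl → ℕ.<-asym u<v w<u })

      rank-injective : ∀ {u v} → A u → A v → ¬ T u → β u ≡ β v → rank u ≡ rank v → u ≡ v
      rank-injective {u} {v} Au Av ¬Tu βu≡βv same with ℕ.<-cmp (toℕ u) (toℕ v)
      ... | tri< u<v _ _ = contradiction same (rank-≢ Au Av ¬Tu βu≡βv u<v)
      ... | tri≈ _ u≡v _ = toℕ-injective u≡v
      ... | tri> _ _ v<u = contradiction (sym same) (rank-≢ Av Au (same-side Au Av ¬Tu βu≡βv) (sym βu≡βv) v<u)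

      -- Every colour f of α hands out two tokens: both to a single vertex v of colour f,
      -- told apart by their index, if v lies in T or has no other vertex of its
      -- colour, and one each to two vertices, told apart by their rank, otherwise.
      data Token (f : Fin (suc m)) (i : Fin 2) : Vertex → Fin 2 → Set where
        on-T : OnT f → Token f i (rep K f) i
        lone : ∀ {v} → A v → ¬ T v → colour α v ≡ f → Lone α v → Token f i v i
        pair : ∀ {v} → A v → ¬ T v → colour α v ≡ f → Token f i v (rank v)

      token-A : ∀ {f i v b} → Token f i v b → A v
      token-A (on-T onT)      = inA K z≤n onT
      token-A (lone Av _ _ _) = Av
      token-A (pair Av _ _)   = Av

      T-rep : ∀ {f} → OnT f → T (rep K f)
      T-rep onT = onT-T onT (inA K z≤n onT) (hue K z≤n onT)

      rep-injective : ∀ {f g} → OnT f → OnT g → β (rep K f) ≡ β (rep K g) → f ≡ g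
      rep-injective {f} {g} p q βf≡βg with ℕ.<-cmp (toℕ f) (toℕ g)
      ... | tri< f<g _ _ = contradiction βf≡βg (β-proper (inA K z≤n p) (inA K z≤n q) (adjacent K z≤n f<g p q))
      ... | tri≈ _ f≡g _ = toℕ-injective f≡g
      ... | tri> _ _ g<f = contradiction (sym βf≡βg) (β-proper (inA K z≤n q) (inA K z≤n p) (adjacent K z≤n g<f q p))

      hues : ∀ {v w f g} → colour α v ≡ f → colour α w ≡ g → v ≡ w → f ≡ g
      hues αv≡f αw≡g v≡w = trans (sym αv≡f) (trans (cong (colour α) v≡w) αw≡g)

      -- Two representatives on `T` are separated by `β`, being adjacent, and no class of `β` meets
      -- both sides of the split. Outside `T`, a lone vertex is identified by its class through
      -- `lone-unique`, and two vertices of kind `pair` by class and rank together.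
      token-determines : ∀ {f i v b g j w c} → Token f i v b → Token g j w c → β v ≡ β w → b ≡ c → f ≡ g
      token-determines (on-T p) (on-T q) βv≡βw _ = rep-injective p q βv≡βw
      token-determines (on-T p) (lone Aw ¬Tw _ _) βv≡βw _ =
        contradiction (T-rep p) (same-side Aw (inA K z≤n p) ¬Tw (sym βv≡βw))
      token-determines (on-T p) (pair Aw ¬Tw _) βv≡βw _ =
        contradiction (T-rep p) (same-side Aw (inA K z≤n p) ¬Tw (sym βv≡βw))
      token-determines (lone Av ¬Tv _ _) (on-T q) βv≡βw _ =
        contradiction (T-rep q) (same-side Av (inA K z≤n q) ¬Tv βv≡βw)
      token-determines (pair Av ¬Tv _) (on-T q) βv≡βw _ =
        contradiction (T-rep q) (same-side Av (inA K z≤n q) ¬Tv βv≡βw)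
      token-determines (lone Av _ αv≡f lonely) (lone Aw ¬Tw αw≡g _) βv≡βw _ =
        hues αv≡f αw≡g (lone-unique Av Aw ¬Tw βv≡βw lonely)
      token-determines (lone Av _ αv≡f lonely) (pair Aw ¬Tw αw≡g) βv≡βw _ =
        hues αv≡f αw≡g (lone-unique Av Aw ¬Tw βv≡βw lonely)
      token-determines (pair Av ¬Tv αv≡f) (lone Aw _ αw≡g lonely) βv≡βw _ =
        hues αv≡f αw≡g (sym (lone-unique Aw Av ¬Tv (sym βv≡βw) lonely))
      token-determines (pair Av ¬Tv αv≡f) (pair Aw _ αw≡g) βv≡βw b≡c =
        hues αv≡f αw≡g (rank-injective Av Aw ¬Tv βv≡βw b≡c)

      record Tokens (f : Fin (suc m)) : Set where
        field
          place    : Fin 2 → Vertex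
          bit      : Fin 2 → Fin 2
          token    : ∀ i → Token f i (place i) (bit i)
          separate : β (place 0F) ≡ β (place 1F) → bit 0F ≢ bit 1F
      open Tokens

      tokens : ∀ f → Tokens f
      tokens f with onT? f | onto f
      ... | yes onT | _ = record
        { place    = const (rep K f)
        ; bit      = id
        ; token    = λ _ → on-T onT
        ; separate = λ _ ()
        }
      ... | no ¬onT | v , Av , αv≡f with any? (λ w → A? w ×-dec (colour α w ≟ f) ×-dec ¬? (w ≟ v))
      ...   | no alone = record
        { place    = const v
        ; bit      = id
        ; token    = λ _ → lone Av (λ Tv → ¬onT (v , Av , Tv , αv≡f)) αv≡f λ w Aw αw≡αv →
                       decidable-stable (w ≟ v) λ w≢v → alone (w , Aw , trans αw≡αv αv≡f , w≢v)
        ; separate = λ _ ()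
        }
      ...   | yes (w , Aw , αw≡f , w≢v) = record
        { place    = λ { 0F → v ; 1F → w }
        ; bit      = λ { 0F → rank v ; 1F → rank w }
        ; token    = λ { 0F → pair Av (¬T-f Av αv≡f) αv≡f ; 1F → pair Aw (¬T-f Aw αw≡f) αw≡f }
        ; separate = λ βv≡βw same → w≢v (sym (rank-injective Av Aw (¬T-f Av αv≡f) βv≡βw same))
        }
        where
        ¬T-f : ∀ {v} → A v → colour α v ≡ f → ¬ T v
        ¬T-f Av αv≡f Tv = ¬onT (_ , Av , Tv , αv≡f)

      -- The `suc m` colours hand out two tokens each, but a token is determined by its class of
      -- `β`, one of `m`, and a bit.
      impossible : ⊥
      impossible = no-injection-×2 code code-injective
        where
        code : Fin (suc m) → Fin 2 → Fin m × Fin 2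
        code f i = fromℕ< (β<m (token-A (token (tokens f) i))) , bit (tokens f) i

        same-colour : ∀ f {i j} → code f i ≡ code f j → i ≡ j
        same-colour f {0F} {0F} _  = refl
        same-colour f {1F} {1F} _  = refl
        same-colour f {0F} {1F} eq = contradiction (cong proj₂ eq)
          (separate (tokens f) (fromℕ<-injective _ _ _ _ (cong proj₁ eq)))
        same-colour f {1F} {0F} eq = contradiction (sym (cong proj₂ eq))
          (separate (tokens f) (fromℕ<-injective _ _ _ _ (sym (cong proj₁ eq))))

        code-injective : ∀ f i g j → code f i ≡ code g j → f ≡ g × i ≡ j
        code-injective f i g j eq
          with refl ← token-determines (token (tokens f) i) (token (tokens g) j)
                        (fromℕ<-injective _ _ _ _ (cong proj₁ eq)) (cong proj₂ eq)
          = refl , same-colour f eq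

    -- Freeing a colour by descent on the potential.

    improve : ∀ α → ∃ (Misses G α) ⊎ Improvement α
    improve α with any? (λ f → all? λ v → A? v →-dec ¬? (colour α v ≟ f))
    ... | yes (f , misses) = inj₁ (f , misses _)
    ... | no ¬missing with any? (λ v → any? λ d → A? v ×-dec T? v ×-dec
                           (toℕ d ℕ.<? toℕ (colour α v)) ×-dec
                           all? λ w → A? w →-dec (v ~? w) →-dec ¬? (colour α w ≟ d))
    ... | yes (v , d , Av , Tv , d<αv , free) = inj₂ (lower-on-T α Av Tv d<αv (free _))
    ... | no ¬lower with any? (λ x → any? λ y → A? x ×-dec A? y ×-dec ¬? (T? y) ×-dec
                         (β x ℕ.≟ β y) ×-dec ¬? (x ≟ y) ×-dec
                         all? λ w → A? w →-dec (colour α w ≟ colour α x) →-dec (w ≟ x))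
    ... | yes (x , y , Ax , Ay , ¬Ty , βx≡βy , x≢y , lone) = inj₂ (merge-off-T α Ax Ay ¬Ty βx≡βy x≢y lone)
    ... | no ¬merge = ⊥-elim (Stuck.impossible α onto greedy lone-unique)
      where
      onto : ∀ f → ∃[ v ] (A v × colour α v ≡ f)
      onto f = decidable-stable (any? λ v → A? v ×-dec (colour α v ≟ f))
        λ none → ¬missing (f , λ v Av αv≡f → none (v , Av , αv≡f))

      greedy : ∀ {v d} → A v → T v → toℕ d < toℕ (colour α v) → ∃[ w ] (A w × v ~ w × colour α w ≡ d)
      greedy {v} {d} Av Tv d<αv = decidable-stable (any? λ w → A? w ×-dec (v ~? w) ×-dec (colour α w ≟ d))
        λ none → ¬lower (v , d , Av , Tv , d<αv , λ w Aw v~w αw≡d → none (w , Aw , v~w , αw≡d))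

      lone-unique : ∀ {x y} → A x → A y → ¬ T y → β x ≡ β y → Lone α x → x ≡ y
      lone-unique {x} {y} Ax Ay ¬Ty βx≡βy lone = decidable-stable (x ≟ y)
        λ x≢y → ¬merge (x , y , Ax , Ay , ¬Ty , βx≡βy , x≢y , lone)

  canFreeColour : CanFreeColour G
  canFreeColour {A} A? β β<m β-proper α = go α (<-wellFounded _)
    where
    go : ∀ α → Acc _<_ (total A? β β<m β-proper α) → ∃[ γ ] (Star (Step G) α γ × ∃ (Misses G γ))
    go α (acc rec) with improve A? β β<m β-proper α
    ... | inj₁ missing = α , ε , missing
    ... | inj₂ (γ , s , γ<α) with go γ (rec γ<α)
    ...   | δ , γ→δ , missing = δ , s ◅ γ→δ , missing

-- Splits of P₄-free and of (P₃+P₁)-free graphs.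

P₄-free⇒split : ∀ {G} → path 4 -free G → Split G
P₄-free⇒split {G} free = record
  { T         = λ _ → ⊤
  ; T?        = λ _ → yes tt
  ; joined    = λ _ ¬tt → contradiction tt ¬tt
  ; no-P₄     = λ _ _ _ _ ab bc cd ac ad bd → free (induced-P₄ G ab bc cd ac ad bd)
  ; no-triple = λ ¬tt → contradiction tt ¬tt
  }

module _ {G : Graph} (free : path 3 ⊕ path 1 -free G) where
  open Graph G

  private
    no-P₃+P₁ : ∀ {a b c d} → a ~ b → b ~ c → a ≢ c → ¬ a ~ c → ¬ a ~ d → ¬ b ~ d → ¬ c ~ d → ⊥
    no-P₃+P₁ ab bc a≢c ac ad bd cd = free (induced-P₃+P₁ G ab bc a≢c ac ad bd cd)

  Independent : Vertex → Vertex → Vertex → Set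
  Independent a b c = a ≢ b × a ≢ c × b ≢ c × ¬ a ~ b × ¬ a ~ c × ¬ b ~ c

  independent? : ∀ a b c → Dec (Independent a b c)
  independent? a b c = ¬? (a ≟ b) ×-dec ¬? (a ≟ c) ×-dec ¬? (b ≟ c)
    ×-dec ¬? (a ~? b) ×-dec ¬? (a ~? c) ×-dec ¬? (b ~? c)

  independent-swap : ∀ {a b c} → Independent a b c → Independent b a c
  independent-swap (a≢b , a≢c , b≢c , ab , ac , bc) = ≢-sym a≢b , b≢c , a≢c , ab ∘ ~-sym , bc , ac

  independent-rotate : ∀ {a b c} → Independent a b c → Independent b c a
  independent-rotate (a≢b , a≢c , b≢c , ab , ac , bc) =
    b≢c , ≢-sym a≢b , ≢-sym a≢c , bc , ab ∘ ~-sym , ac ∘ ~-sym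

  InTriple : Vertex → Set
  InTriple a = ∃₂ λ b c → Independent a b c

  -- Otherwise the path `a`, `v`, `b` and the vertex `c` induce a P₃+P₁.
  sees-third : ∀ {a b c v} → Independent a b c → v ~ a → v ~ b → v ~ c
  sees-third {c = c} {v} (a≢b , _ , _ , ab , ac , bc) v~a v~b = decidable-stable (v ~? c) λ v≁c →
    no-P₃+P₁ (~-sym v~a) v~b a≢b ab ac v≁c bc

  -- Suppose `u` and `v` are not adjacent. Then `v` sees both `p` and `q`, or it would form an
  -- independent triple with `u` and one of them; so by `sees-third` it sees `u` after all.
  inTriple-joined : ∀ {u v} → InTriple u → ¬ InTriple v → u ~ v
  inTriple-joined {u} {v} (p , q , upq) ¬Tv = decidable-stable (u ~? v) λ u≁v →
    let
      sees : ∀ {a} → InTriple a → u ≢ a → ¬ u ~ a → v ~ a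
      sees {a} Ta u≢a u≁a = decidable-stable (v ~? a) λ v≁a →
        ¬Tv (u , a , v≢ (p , q , upq) , v≢ Ta , u≢a , u≁v ∘ ~-sym , v≁a , u≁a)
      (u≢p , u≢q , _ , u≁p , u≁q , _) = upq
      pqu = independent-rotate upq
    in u≁v (~-sym (sees-third pqu (sees (q , u , pqu) u≢p u≁p)
                                  (sees (u , p , independent-rotate pqu) u≢q u≁q)))
    where
    v≢ : ∀ {a} → InTriple a → v ≢ a
    v≢ Ta refl = ¬Tv Ta

  -- By `sees-third`, a vertex adjacent to two of `b`, `p`, `q` is adjacent to the third. According
  -- to which of `a`, `c`, `d` see `p`, a P₃+P₁ is formed by `a b c` with `p`, by `p c q` with `a`,
  -- by `b a p` with `d`, or by `b a q` with `d`.
  inTriple-no-P₄ : ∀ {a b c d} → InTriple b →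
    a ~ b → b ~ c → c ~ d → ¬ a ~ c → ¬ a ~ d → ¬ b ~ d → ⊥
  inTriple-no-P₄ {a} {b} {c} {d} (p , q , bpq@(b≢p , b≢q , p≢q , b≁p , b≁q , p≁q))
                 ab bc cd ac ad bd
    with a ~? p | c ~? p
  ... | no a≁p  | no c≁p  = no-P₃+P₁ ab bc (λ { refl → ad cd }) ac a≁p b≁p c≁p
  ... | no a≁p  | yes c~p = no-P₃+P₁ (~-sym c~p) c~q p≢q p≁q (a≁p ∘ ~-sym) (ac ∘ ~-sym) (a≁q ∘ ~-sym)
    where
    c~q = sees-third bpq (~-sym bc) c~p
    a≁q : ¬ a ~ q
    a≁q a~q = a≁p (sees-third (independent-rotate (independent-swap bpq)) ab a~q)
  ... | yes a~p | _ with d ~? p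
  ...   | no d≁p  = no-P₃+P₁ (~-sym ab) a~p b≢p b≁p bd ad (d≁p ∘ ~-sym)
  ...   | yes d~p = no-P₃+P₁ (~-sym ab) (sees-third bpq ab a~p) b≢q b≁q bd ad
    λ q~d → bd (~-sym (sees-third (independent-rotate bpq) d~p (~-sym q~d)))

  P₃+P₁-free⇒split : Split G
  P₃+P₁-free⇒split = record
    { T         = InTriple
    ; T?        = λ a → any? λ b → any? λ c → independent? a b c
    ; joined    = inTriple-joined
    ; no-P₄     = λ _ Tb _ _ → inTriple-no-P₄ Tb
    ; no-triple = λ ¬Ta _ _ a≢b a≢c b≢c ab ac bc → ¬Ta (_ , _ , a≢b , a≢c , b≢c , ab , ac , bc)
    }

-- From partial colourings back to the reconfiguration graph.

module _ {G : Graph} where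
  open Graph G

  private
    module C = Colouring
    module P = Partial

  -- Steps that change nothing are dropped. The colouring reached so far then agrees with the
  -- partial one only pointwise, so the induction carries `α` along with this agreement.
  Star-Step⇒Star-Recolour : ∀ {A k} → (∀ v → A v) → {π ρ : Partial G A k} → Star (Step G) π ρ →
    (α : Colouring G k) → C.colour α ≗ P.colour π →
    ∃[ γ ] (Star (Recolour G) α γ × C.colour γ ≗ P.colour ρ)
  Star-Step⇒Star-Recolour all ε α α≗π = α , ε , α≗π
  Star-Step⇒Star-Recolour all (_◅_ {j = σ} (step unique) σ→ρ) α α≗π
    with any? (λ v → ¬? (C.colour α v ≟ P.colour σ v))
  ... | no same = Star-Step⇒Star-Recolour all σ→ρ α λ v →
    decidable-stable (C.colour α v ≟ P.colour σ v) λ αv≢σv → same (v , αv≢σv)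
  ... | yes (v , αv≢σv) with Star-Step⇒Star-Recolour all σ→ρ
      (record { colour = P.colour σ ; proper = λ u w → P.proper σ (all u) (all w) }) (λ _ → refl)
  ...   | γ , σ→γ , γ≗ρ = γ , (v , αv≢σv , only-v) ◅ σ→γ , γ≗ρ
    where
    only-v : ∀ w → w ≢ v → C.colour α w ≡ P.colour σ w
    only-v w w≢v = decidable-stable (C.colour α w ≟ P.colour σ w) λ αw≢σw →
      w≢v (unique (all w) (all v) (αw≢σw ∘ trans (α≗π w)) (αv≢σv ∘ trans (α≗π v)))

  split⇒mixing : Split G → ∀ ℓ → ℓ ≥ χ G + 1 → Mixing G ℓ
  split⇒mixing split zero    ℓ≥χ+1 = contradiction (ℕ.m+n≤o⇒n≤o (χ G) ℓ≥χ+1) λ ()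
  split⇒mixing split (suc ℓ) ℓ≥χ+1 α γ =
    Star-Step⇒Star-Recolour below
      (linked G (canFreeColour split) (toℕ ∘ C.colour β) (λ u~v → C.proper β _ _ u~v ∘ toℕ-injective)
        ℓ (partial α) (partial γ))
      α (λ _ → refl)
    where
    β = proj₁ (χ-isChromaticNumber G)

    -- An optimal colouring has at most `ℓ` classes, so `Below ℓ` contains every vertex.
    below : ∀ v → toℕ (C.colour β v) < ℓ
    below v = ℕ.<-≤-trans (toℕ<n _) (s≤s⁻¹ (subst (_≤ suc ℓ) (ℕ.+-comm (χ G) 1) ℓ≥χ+1))

    partial : ∀ {A} → Colouring G (suc ℓ) → Partial G A (suc ℓ)
    partial α = C.colour α ,ₚ λ _ _ → C.proper α _ _

theorem3 : (H : Graph) →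
    ((G : Graph) → H -free G → (ℓ : ℕ) → ℓ ≥ χ G + 1 → Mixing G ℓ)
    ⇔
    (InducedSubgraph H (path 4) ⊎ InducedSubgraph H (path 3 ⊕ path 1))
theorem3 H = mk⇔ (mixing⇒induced H) λ H⊆ G H-free → split⇒mixing (split H⊆ H-free)
  where
  split : ∀ {G} → InducedSubgraph H (path 4) ⊎ InducedSubgraph H (path 3 ⊕ path 1) → H -free G → Split G
  split (inj₁ H⊆P₄)    H-free = P₄-free⇒split (H-free ∘ InducedSubgraph-trans H⊆P₄)
  split (inj₂ H⊆P₃+P₁) H-free = P₃+P₁-free⇒split (H-free ∘ InducedSubgraph-trans H⊆P₃+P₁)
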